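{- Let $T_n\subseteq{}^{\omega>}2$ (for $n<\omega$) be trees with no maximal nodes, $\bar{T}=\langle T_n:n<\omega\rangle$, $B=\bigcup_{n<\omega}\lim(T_n)$, and let $2\leq\iota<\omega$, $k=2\iota$. Let $\varepsilon\leq\omega_1$ be an ordinal and $\lambda$ an uncountable cardinal such that ${\rm Pr}_\varepsilon(\lambda)$ holds. If there is $A\subseteq{}^{\omega}2$ of cardinality $\lambda$ such that $|(B+\eta)\cap(B+\nu)|\geq k$ for all $\eta,\nu\in A$, then ${\rm NDRK}(\bar{T})\geq\varepsilon$.
   Context: ${}^{\omega>}2$ is the set of finite 0-1 sequences, ${}^{\ell}2$ those of length $\ell$; ${}^{\omega}2$ is the Cantor space; $+$ is coordinatewise addition modulo 2; $\nu\vartriangleleft\eta$ means that $\nu$ is a proper initial segment of $\eta$. For a tree $T\subseteq{}^{\omega>}2$, $\lim(T)$ is the set of its infinite branches in ${}^{\omega}2$. For a set $u$, $u^{\langle2\rangle}=\{(x,y)\in u\times u:x\neq y\}$. $\mathbf{M}_{\bar{T},k}$ consists of all tuples $\mathbf{m}=(\ell_{\mathbf{m}},u_{\mathbf{m}},\bar{h}_{\mathbf{m}},\bar{g}_{\mathbf{m}})=(\ell,u,\bar{h},\bar{g})$ such that: (i) $0<\ell<\omega$, $u\subseteq{}^{\ell}2$ and $2\leq|u|$; (ii) $\bar{h}=\langle h_i:i<\iota\rangle$, $\bar{g}=\langle g_i:i<\iota\rangle$, with $h_i:u^{\langle2\rangle}\to\omega$ and $g_i:u^{\langle2\rangle}\to\bigcup_{n<\omega}(T_n\cap{}^{\ell}2)$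 for each $i<\iota$; (iii) $g_i(\eta,\nu)\in T_{h_i(\eta,\nu)}\cap{}^{\ell}2$ for all $(\eta,\nu)\in u^{\langle2\rangle}$, $i<\iota$; (iv) $\eta+g_i(\eta,\nu)=\nu+g_i(\nu,\eta)$ for all $(\eta,\nu)\in u^{\langle2\rangle}$, $i<\iota$; (v) for any $(\eta,\nu)\in u^{\langle2\rangle}$ there are no repetitions in the sequence $\langle g_i(\eta,\nu),g_i(\nu,\eta):i<\iota\rangle$. The components of $\bar h_{\mathbf m},\bar g_{\mathbf m}$ are written $h^{\mathbf m}_i,g^{\mathbf m}_i$. Extension: $\mathbf{m}\sqsubseteq\mathbf{n}$ iff $\ell_{\mathbf{m}}\leq\ell_{\mathbf{n}}$, $u_{\mathbf{m}}=\{\eta\restriction\ell_{\mathbf{m}}:\eta\in u_{\mathbf{n}}\}$, and for every $(\eta,\nu)\in(u_{\mathbf{n}})^{\langle2\rangle}$ with $\eta\restriction\ell_{\mathbf{m}}\neq\nu\restriction\ell_{\mathbf{m}}$ and each $i<\iota$: $h^{\mathbf{m}}_i(\eta\restriction\ell_{\mathbf{m}},\nu\restriction\ell_{\mathbf{m}})=h^{\mathbf{n}}_i(\eta,\nu)$ and $g^{\mathbf{m}}_i(\eta\restriction\ell_{\mathbf{m}},\nu\restriction\ell_{\mathbf{m}})=g^{\mathbf{n}}_i(\eta,\nu)\restriction\ell_{\mathbf{m}}$. Rank ${\rm ndrk}:\mathbf{M}_{\bar{T},k}\to{\rm ON}\cup\{\infty\}$, defined by declaring inductively when ${\rm ndrk}(\mathbf{m})\geq\alpha$: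 ${\rm ndrk}(\mathbf{m})\geq0$ always; for limit $\alpha$, ${\rm ndrk}(\mathbf{m})\geq\alpha$ iff ${\rm ndrk}(\mathbf{m})\geq\beta$ for all $\beta<\alpha$; ${\rm ndrk}(\mathbf{m})\geq\beta+1$ iff for every $\nu\in u_{\mathbf{m}}$ there is $\mathbf{n}\in\mathbf{M}_{\bar{T},k}$ with $\ell_{\mathbf{n}}>\ell_{\mathbf{m}}$, $\mathbf{m}\sqsubseteq\mathbf{n}$, ${\rm ndrk}(\mathbf{n})\geq\beta$ and $|\{\eta\in u_{\mathbf{n}}:\nu\vartriangleleft\eta\}|\geq2$; ${\rm ndrk}(\mathbf{m})=\infty$ iff ${\rm ndrk}(\mathbf{m})\geq\alpha$ for all ordinals $\alpha$. ${\rm NDRK}(\bar{T})=\sup\{{\rm ndrk}(\mathbf{m})+1:\mathbf{m}\in\mathbf{M}_{\bar{T},k}\}$ (with $\infty+1=\infty$). Model rank. Let $\mathbb{M}$ be a model with universe a cardinal $\lambda$ and a countable vocabulary $\tau$. For finite non-empty $w=\{a_0,\ldots,a_n\}\subseteq\lambda$ with $|w|=n+1$, define ${\rm rk}(w,\mathbb{M})\geq\alpha$ by induction on ordinals $\alpha$: - ${\rm rk}(w,\mathbb{M})\geq 0$ iff for every quantifier free formula $\varphi\in\mathcal{L}(\tau)$ and each $j\leq n$, if $\mathbb{M}\models\varphi[a_0,\ldots,a_j,\ldots,a_n]$ then the set $\{a\in\lambda:\mathbb{M}\models\varphi[a_0,\ldots,a_{j-1},a,a_{j+1},\ldots,a_n]\}$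 is uncountable; - for limit $\alpha$, ${\rm rk}(w,\mathbb{M})\geq\alpha$ iff ${\rm rk}(w,\mathbb{M})\geq\beta$ for all $\beta<\alpha$; - ${\rm rk}(w,\mathbb{M})\geq\alpha+1$ iff for every quantifier free $\varphi\in\mathcal{L}(\tau)$ and each $j\leq n$, if $\mathbb{M}\models\varphi[a_0,\ldots,a_j,\ldots,a_n]$ then there is $a^*\in\lambda\setminus w$ with ${\rm rk}(w\cup\{a^*\},\mathbb{M})\geq\alpha$ and $\mathbb{M}\models\varphi[a_0,\ldots,a_{j-1},a^*,a_{j+1},\ldots,a_n]$. ${\rm rk}(w,\mathbb{M})=-1$ if not ${\rm rk}(w,\mathbb{M})\geq0$; $=\infty$ if ${\rm rk}(w,\mathbb{M})\geq\alpha$ for all $\alpha$; $=\alpha$ if ${\rm rk}(w,\mathbb{M})\geq\alpha$ but not $\geq\alpha+1$. ${\rm NPr}_{\varepsilon}(\lambda)$ says: there is a model $\mathbb{M}^*$ with universe $\lambda$ and a countable vocabulary such that $\sup\{{\rm rk}(w,\mathbb{M}^*):\emptyset\neq w\in[\lambda]^{<\omega}\}<\varepsilon$; ${\rm Pr}_\varepsilon(\lambda)$ is its negation. -}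

module Defs where

open import Level using (Level; 0ℓ; _⊔_) renaming (suc to lsuc)
open import Data.Bool.Base using (Bool; T; _xor_)
open import Data.Empty using (⊥)
open import Data.Fin.Base using (Fin)
open import Data.List.Base using (List; applyUpTo)
open import Data.List.Relation.Binary.Prefix.Heterogeneous using (Prefix)
open import Data.Nat.Base using (ℕ; suc; _≤_; _<_)
open import Data.Product.Base using (Σ; ∃; ∃-syntax; _×_; _,_; proj₁; proj₂)
open import Data.Sum.Base as Sum using (_⊎_)
open import Data.Unit.Base using (⊤)
open import Data.Vec.Base using (Vec; []; _∷_; lookup; toList; truncate; zipWith; _[_]≔_)
open import Data.Vec.Membership.Propositional using (_∉_)
open import Data.Vec.Relation.Unary.Unique.Propositional using (Unique)
open import Function.Bundles using (Injection; Bijection)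
open import Function.Definitions using (Injective)
open import Relation.Binary.Bundles using (Setoid)
open import Relation.Binary.Core using (Rel)
import Relation.Binary.Construct.On as On
import Relation.Binary.Construct.Add.Infimum.NonStrict as Inf
import Relation.Binary.Construct.Add.Infimum.Strict as InfStrict
import Relation.Binary.Construct.Add.Supremum.NonStrict as Sup
import Relation.Binary.Construct.Add.Supremum.Strict as SupStrict
open import Relation.Binary.PropositionalEquality using (_≡_; refl; _≢_; _≗_; _→-setoid_; setoid; ≢-sym)
open import Relation.Nullary.Construct.Add.Infimum using (_₋; ⊥₋) renaming ([_] to [_]₋)
open import Relation.Nullary.Construct.Add.Supremum using (_⁺; ⊤⁺; [_])
open import Relation.Nullary.Negation.Core using (¬_)
open import Relation.Unary using (Pred; _≐_)

private
  variable
    a ℓ p : Level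

------------------------------------------------------------------------
-- Cardinality

Subsetoid : (S : Setoid a ℓ) → Pred (Setoid.Carrier S) p → Setoid (a ⊔ p) ℓ
Subsetoid S P = On.setoid {B = ∃ P} S proj₁

Countable Uncountable : Setoid a ℓ → Set (a ⊔ ℓ)
Countable S = Injection S (setoid ℕ)
Uncountable S = ¬ Countable S

AtLeast : ℕ → Setoid a ℓ → Set (a ⊔ ℓ)
AtLeast k S = Injection (setoid (Fin k)) S

-- A cardinal is given by a set having that many elements.
HasCardinality : Setoid a ℓ → Set → Set (a ⊔ ℓ)
HasCardinality S Λ = Bijection (setoid Λ) S

IsSup : {A : Set a} → Rel A ℓ → Pred A p → Pred A (a ⊔ ℓ ⊔ p)
IsSup _≼_ S σ = (∀ {s} → S s → s ≼ σ) × (∀ {b} → (∀ {s} → S s → s ≼ b) → σ ≼ b)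

------------------------------------------------------------------------
-- Ordinals

-- sup⁺ f is the least ordinal strictly above every f i.  Ordinals are
-- identified up to _≈ₒ_.
data Ord : Set₁ where
  sup⁺ : {I : Set} → (I → Ord) → Ord

infix 4 _≤ₒ_ _<ₒ_ _≈ₒ_

mutual
  _≤ₒ_ : Rel Ord 0ℓ
  sup⁺ f ≤ₒ β = ∀ i → f i <ₒ β

  _<ₒ_ : Rel Ord 0ℓ
  α <ₒ sup⁺ g = ∃[ j ] α ≤ₒ g j

_≈ₒ_ : Rel Ord 0ℓ
α ≈ₒ β = (α ≤ₒ β) × (β ≤ₒ α)

≤ₒ-refl : ∀ α → α ≤ₒ α
≤ₒ-refl (sup⁺ f) i = i , ≤ₒ-refl (f i)

mutual
  ≤ₒ-trans : ∀ α β γ → α ≤ₒ β → β ≤ₒ γ → α ≤ₒ γ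
  ≤ₒ-trans (sup⁺ f) β γ p q i = <ₒ-≤ₒ-trans (f i) β γ (p i) q

  <ₒ-≤ₒ-trans : ∀ α β γ → α <ₒ β → β ≤ₒ γ → α <ₒ γ
  <ₒ-≤ₒ-trans α (sup⁺ g) γ (j , p) q = ≤ₒ-<ₒ-trans α (g j) γ p (q j)

  ≤ₒ-<ₒ-trans : ∀ α β γ → α ≤ₒ β → β <ₒ γ → α <ₒ γ
  ≤ₒ-<ₒ-trans α β (sup⁺ h) p (k , q) = k , ≤ₒ-trans α β (h k) p q

Ordₛ : Setoid (lsuc 0ℓ) 0ℓ
Ordₛ = record
  { Carrier = Ord
  ; _≈_ = _≈ₒ_
  ; isEquivalence = record
    { refl  = λ {α} → ≤ₒ-refl α , ≤ₒ-refl α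
    ; sym   = λ (p , q) → q , p
    ; trans = λ {α} {β} {γ} (p , q) (r , s) → ≤ₒ-trans α β γ p r , ≤ₒ-trans γ β α s q
    }
  }

zeroₒ : Ord
zeroₒ = sup⁺ {⊥} λ ()

sucₒ : Ord → Ord
sucₒ α = sup⁺ {⊤} λ _ → α

IsLimit : Pred Ord (lsuc 0ℓ)
IsLimit α = (zeroₒ <ₒ α) × (∀ β → β <ₒ α → sucₒ β <ₒ α)

-- ω₁
IsFirstUncountable : Pred Ord (lsuc 0ℓ)
IsFirstUncountable α =
  Uncountable (Subsetoid Ordₛ (_<ₒ α)) × (∀ β → β <ₒ α → Countable (Subsetoid Ordₛ (_<ₒ β)))

-- ON ∪ {∞}
Ord∞ : Set₁
Ord∞ = Ord ⁺

open Sup _≤ₒ_ public using () renaming (_≤⁺_ to _≤∞_)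
open SupStrict _<ₒ_ public using () renaming (_<⁺_ to _<∞_)

suc∞ : Ord∞ → Ord∞
suc∞ [ α ] = [ sucₒ α ]
suc∞ ⊤⁺    = ⊤⁺

-- {-1} ∪ ON ∪ {∞}, where -1 is ⊥₋
Rank : Set₁
Rank = Ord∞ ₋

open Inf _≤∞_ public using () renaming (_≤₋_ to _≤ᵣ_)
open InfStrict _<∞_ public using () renaming (_<₋_ to _<ᵣ_)

------------------------------------------------------------------------
-- Finite and infinite 0-1 sequences

infix 4 _◁_

_◁_ : Rel (List Bool) 0ℓ
σ ◁ τ = Prefix _≡_ σ τ × σ ≢ τ

IsTree : Pred (Pred (List Bool) 0ℓ) 0ℓ
IsTree S = ∀ {σ τ} → σ ◁ τ → S τ → S σ

NoMaximalNodes : Pred (Pred (List Bool) 0ℓ) 0ℓ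
NoMaximalNodes S = ∀ {σ} → S σ → ∃[ τ ] S τ × σ ◁ τ

Cantor : Set
Cantor = ℕ → Bool

Cantorₛ : Setoid 0ℓ 0ℓ
Cantorₛ = ℕ →-setoid Bool

lim : Pred (List Bool) 0ℓ → Pred Cantor 0ℓ
lim S x = ∀ n → S (applyUpTo x n)

⋃lim : (ℕ → Pred (List Bool) 0ℓ) → Pred Cantor 0ℓ
⋃lim S x = ∃[ n ] lim (S n) x

infixl 6 _+ᶜ_ _+ᵛ_ _+ˢ_

_+ᶜ_ : Cantor → Cantor → Cantor
(x +ᶜ y) n = x n xor y n

_+ᵛ_ : ∀ {n} → Vec Bool n → Vec Bool n → Vec Bool n
_+ᵛ_ = zipWith _xor_

_+ˢ_ : Pred Cantor 0ℓ → Cantor → Pred Cantor 0ℓ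
(X +ˢ η) x = ∃[ b ] X b × x ≗ b +ᶜ η

------------------------------------------------------------------------
-- The family 𝐌 for T̄ and k = 2ι

FinSubset : ℕ → Set
FinSubset l = Vec Bool l → Bool

infix 4 _∈ᵤ_

_∈ᵤ_ : ∀ {l} → Vec Bool l → FinSubset l → Set
η ∈ᵤ u = T (u η)

-- The proofs are irrelevant, so functions out of u ⟨2⟩ depend only on the
-- two sequences.
record _⟨2⟩ {l} (u : FinSubset l) : Set where
  constructor pair
  field
    left right : Vec Bool l
    .left∈     : left ∈ᵤ u
    .right∈    : right ∈ᵤ u
    .distinct  : left ≢ right

open _⟨2⟩ public

swap : ∀ {l} {u : FinSubset l} → u ⟨2⟩ → u ⟨2⟩
swap (pair η ν η∈ ν∈ η≢ν) = pair ν η ν∈ η∈ (≢-sym η≢ν)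

record 𝐌 (S : ℕ → Pred (List Bool) 0ℓ) (ι : ℕ) : Set where
  field
    len      : ℕ
    u        : FinSubset len
    h        : Fin ι → u ⟨2⟩ → ℕ
    g        : Fin ι → u ⟨2⟩ → Vec Bool len
    0<len    : 0 < len
    2≤∣u∣    : AtLeast 2 (Subsetoid (setoid (Vec Bool len)) (_∈ᵤ u))
    g∈       : ∀ i q → S (h i q) (toList (g i q))
    balanced : ∀ i q → left q +ᵛ g i q ≡ right q +ᵛ g i (swap q)
    distinct-g : ∀ q → Injective {A = Fin ι ⊎ Fin ι} _≡_ _≡_ Sum.[ (λ i → g i q) , (λ i → g i (swap q)) ]

module _ {S : ℕ → Pred (List Bool) 0ℓ} {ι : ℕ} where

  open 𝐌

  infix 4 _⊑_

  record _⊑_ (m n : 𝐌 S ι) : Set where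
    field
      len≤ : len m ≤ len n

    _↾ : Vec Bool (len n) → Vec Bool (len m)
    _↾ = truncate len≤

    field
      u≐ : (_∈ᵤ u m) ≐ (λ σ → ∃[ η ] (η ∈ᵤ u n) × (σ ≡ η ↾))

    restrict : (q : u n ⟨2⟩) → .(left q ↾ ≢ right q ↾) → u m ⟨2⟩
    restrict (pair η ν η∈ ν∈ _) ne =
      pair (η ↾) (ν ↾) (proj₂ u≐ (η , η∈ , refl)) (proj₂ u≐ (ν , ν∈ , refl)) ne

    field
      h≡ : ∀ i q (ne : left q ↾ ≢ right q ↾) → h m i (restrict q ne) ≡ h n i q
      g≡ : ∀ i q (ne : left q ↾ ≢ right q ↾) → g m i (restrict q ne) ≡ g n i q ↾

  -- Ndrk≥ m α says ndrk(m) ≥ α.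
  data Ndrk≥ (m : 𝐌 S ι) (α : Ord) : Set₁ where
    at-zero  : α ≈ₒ zeroₒ → Ndrk≥ m α
    at-limit : IsLimit α → (∀ β → β <ₒ α → Ndrk≥ m β) → Ndrk≥ m α
    at-suc   : ∀ β → α ≈ₒ sucₒ β →
               (∀ ν → ν ∈ᵤ u m → ∃[ n ] (len m < len n) × (m ⊑ n) × Ndrk≥ n β ×
                 AtLeast 2 (Subsetoid (setoid (Vec Bool (len n)))
                                      (λ η → (η ∈ᵤ u n) × (toList ν ◁ toList η)))) →
               Ndrk≥ m α

  -- HasNdrk m r says ndrk(m) = r.
  data HasNdrk (m : 𝐌 S ι) : Ord∞ → Set₁ where
    ordinal  : ∀ {α} → Ndrk≥ m α → ¬ Ndrk≥ m (sucₒ α) → HasNdrk m [ α ]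
    infinite : (∀ α → Ndrk≥ m α) → HasNdrk m ⊤⁺

-- HasNDRK S ι σ says NDRK(S) = σ; the supremum is taken in ON ∪ {∞}.
HasNDRK : (ℕ → Pred (List Bool) 0ℓ) → ℕ → Ord∞ → Set₁
HasNDRK S ι = IsSup _≤∞_ (λ s → ∃[ m ] ∃[ r ] HasNdrk {S} {ι} m r × (s ≡ suc∞ r))

------------------------------------------------------------------------
-- First-order models and quantifier-free formulas

record Vocabulary : Set₁ where
  field
    RelSym FunSym : Set
    relArity      : RelSym → ℕ
    funArity      : FunSym → ℕ
    countable     : Countable (setoid (RelSym ⊎ FunSym))

module _ (τ : Vocabulary) where

  open Vocabulary τ

  data Term (n : ℕ) : Set where
    var : Fin n → Term n
    app : (f : FunSym) → Vec (Term n) (funArity f) → Term n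

  data QFFormula (n : ℕ) : Set where
    equal         : Term n → Term n → QFFormula n
    rel           : (R : RelSym) → Vec (Term n) (relArity R) → QFFormula n
    neg           : QFFormula n → QFFormula n
    and or imp    : QFFormula n → QFFormula n → QFFormula n

  record Model (Λ : Set) : Set₁ where
    field
      relI : (R : RelSym) → Vec Λ (relArity R) → Set
      funI : (f : FunSym) → Vec Λ (funArity f) → Λ

module _ {τ : Vocabulary} {Λ : Set} (M : Model τ Λ) where

  open Model M

  mutual
    evalTerm : ∀ {n} → Vec Λ n → Term τ n → Λ
    evalTerm w (var i)    = lookup w i
    evalTerm w (app f ts) = funI f (evalTerms w ts)

    evalTerms : ∀ {n k} → Vec Λ n → Vec (Term τ n) k → Vec Λ k
    evalTerms w []       = []
    evalTerms w (t ∷ ts) = evalTerm w t ∷ evalTerms w ts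

  Sat : ∀ {n} → QFFormula τ n → Vec Λ n → Set
  Sat (equal s t) w = evalTerm w s ≡ evalTerm w t
  Sat (rel R ts)  w = relI R (evalTerms w ts)
  Sat (neg φ)     w = ¬ Sat φ w
  Sat (and φ ψ)   w = Sat φ w × Sat ψ w
  Sat (or φ ψ)    w = Sat φ w ⊎ Sat ψ w
  Sat (imp φ ψ)   w = Sat φ w → Sat ψ w

  -- Rk≥ w α says rk(w, M) ≥ α, where the set w is given by an enumeration
  -- (a₀, …, aₙ) without repetitions; the choice of enumeration is immaterial
  -- because φ ranges over all formulas in n+1 variables.
  data Rk≥ {n : ℕ} (w : Vec Λ (suc n)) (α : Ord) : Set₁ where
    at-zero  : α ≈ₒ zeroₒ →
               (∀ (φ : QFFormula τ (suc n)) j → Sat φ w →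
                 Uncountable (Subsetoid (setoid Λ) (λ a → Sat φ (w [ j ]≔ a)))) →
               Rk≥ w α
    at-limit : IsLimit α → (∀ β → β <ₒ α → Rk≥ w β) → Rk≥ w α
    at-suc   : ∀ β → α ≈ₒ sucₒ β →
               (∀ (φ : QFFormula τ (suc n)) j → Sat φ w →
                 ∃[ a* ] (a* ∉ w) × Rk≥ (a* ∷ w) β × Sat φ (w [ j ]≔ a*)) →
               Rk≥ w α

  -- HasRk w r says rk(w, M) = r.
  data HasRk {n : ℕ} (w : Vec Λ (suc n)) : Rank → Set₁ where
    minus-one : ¬ Rk≥ w zeroₒ → HasRk w ⊥₋
    ordinal   : ∀ {α} → Rk≥ w α → ¬ Rk≥ w (sucₒ α) → HasRk w [ [ α ] ]₋
    infinite  : (∀ α → Rk≥ w α) → HasRk w [ ⊤⁺ ]₋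

NPr Pr : Ord → Set → Set₁
NPr ε Λ = Σ Vocabulary λ τ → Σ (Model τ Λ) λ M → ∃[ σ ]
  IsSup _≤ᵣ_ (λ r → ∃[ n ] Σ (Vec Λ (suc n)) λ w → Unique w × HasRk M w r) σ × (σ <ᵣ [ [ ε ] ]₋)
Pr ε Λ = ¬ NPr ε Λ

{-# OPTIONS --safe #-}
module Submission where

-- Fix, symmetrically in a and b, common points of the translates of B by η a
-- and η b, and let the model on Λ record every digit of this data by binary
-- relations.  A finite set w of at least two points, cut at a level separating
-- its data, is an element of 𝐌.  The diagram of w up to that level is a
-- quantifier-free formula, so a point a* provided by the model rank yields an
-- extension in 𝐌 that splits the prescribed node.  Hence rk(w) ≥ α implies
-- ndrk ≥ α for the realised element, singletons gain at most one more step, and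
-- NDRK < ε would give a model witnessing NPr.

open import Defs
open import Axiom.ExcludedMiddle using (ExcludedMiddle)
open import Data.Bool.Base using (Bool; true; false; _xor_)
open import Data.Bool.Properties as Bool using (xor-comm)
open import Data.Empty using (⊥; ⊥-elim-irr)
open import Data.Fin.Base using (Fin; zero; suc; toℕ; fromℕ<)
open import Data.Fin.Properties using (any?; toℕ-fromℕ<; toℕ-injective; suc-injective)
open import Data.List.Base using (List; applyUpTo; length)
open import Data.List.Relation.Binary.Prefix.Heterogeneous using (Prefix; []; _∷_)
open import Data.Nat.Base using (ℕ; zero; suc; _+_; _*_; _≤_; _<_; _⊔_; z≤n; s≤s)
open import Data.Nat.Binary.Base as ℕᵇ using (ℕᵇ; 2[1+_]; 1+[2_])
import Data.Nat.Binary.Properties as ℕᵇ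
import Data.Nat.Properties as ℕ
open import Data.Product.Base using (Σ; ∃; ∃-syntax; _×_; _,_; proj₁; proj₂)
open import Data.Sum.Base as Sum using (_⊎_; inj₁; inj₂)
open import Data.Vec.Base using (Vec; []; _∷_; lookup; toList; truncate; _[_]≔_)
open import Data.Vec.Membership.Propositional using (_∉_)
open import Data.Vec.Properties using (≡-dec; ∷-injective; length-toList; lookup∘update; lookup∘update′)
open import Data.Vec.Relation.Unary.All using (All; []; _∷_)
open import Data.Vec.Relation.Unary.AllPairs using ([]; _∷_)
open import Data.Vec.Relation.Unary.Any using (here; there)
open import Data.Vec.Relation.Unary.Unique.Propositional using (Unique)
open import Data.Vec.Relation.Unary.Unique.Propositional.Properties using (lookup-injective)
open import Function.Base using (_∘_)
open import Function.Bundles using (Injection; Bijection)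
open import Function.Definitions using (Injective)
open import Induction.WellFounded using (Acc; acc)
open import Level using (0ℓ; lift; lower) renaming (suc to lsuc)
open import Relation.Binary.Bundles using (Setoid)
open import Relation.Binary.Definitions using (_Respects_; tri<; tri≈; tri>)
open import Relation.Binary.PropositionalEquality using (_≡_; refl; sym; trans; cong; cong₂; subst; _≢_; _≗_; setoid; module ≡-Reasoning)
open import Relation.Nullary.Construct.Add.Infimum using (⊥₋) renaming ([_] to [_]₋)
open import Relation.Nullary.Construct.Add.Supremum using (⊤⁺; [_])
open import Relation.Nullary.Decidable using (Dec; yes; no; ⌊_⌋; toWitness; fromWitness; recompute; map′; decidable-stable)
open import Relation.Nullary.Negation using (¬_; contradiction)
open import Relation.Unary using (Pred; _∩_)
import Relation.Binary.Construct.Add.Infimum.NonStrict as Inf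
import Relation.Binary.Construct.Add.Infimum.Strict as InfStrict
import Relation.Binary.Construct.Add.Supremum.NonStrict as Sup
import Relation.Binary.Construct.Add.Supremum.Strict as SupStrict

open Inf _≤∞_ using (⊥₋≤_) renaming ([_] to [_]≤₋)
open InfStrict _<∞_ using (⊥₋<[_]) renaming ([_] to [_]<₋)
open Sup _≤ₒ_ using (_≤⊤⁺) renaming ([_] to [_]≤)
open SupStrict _<ₒ_ using () renaming ([_] to [_]<)

-- Ordinals

<ₒ-irrefl : ∀ α → ¬ α <ₒ α
<ₒ-irrefl (sup⁺ f) (j , p) = <ₒ-irrefl (f j) (p j)

<ₒ⇒≤ₒ : ∀ α β → α <ₒ β → α ≤ₒ β
<ₒ⇒≤ₒ (sup⁺ f) (sup⁺ g) (j , p) i = j , <ₒ⇒≤ₒ (f i) (g j) (p i)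

-- Allowing every `β` below `α` makes the claim provable by structural recursion on `α`.
<ₒ-accessible : ∀ α β → β ≤ₒ α → Acc _<ₒ_ β
<ₒ-accessible (sup⁺ f) β β≤α = acc λ {γ} γ<β →
  let (j , γ≤fj) = <ₒ-≤ₒ-trans γ β (sup⁺ f) γ<β β≤α in <ₒ-accessible (f j) γ γ≤fj

<ₒ-acc : ∀ α → Acc _<ₒ_ α
<ₒ-acc α = <ₒ-accessible α α (≤ₒ-refl α)

data OrdView (α : Ord) : Set₁ where
  is-zero  : α ≈ₒ zeroₒ → OrdView α
  is-limit : IsLimit α → OrdView α
  is-suc   : ∀ β → α ≈ₒ sucₒ β → OrdView α

-- Comparison of ordinals, suprema and the existence of ranks, by excluded middle

module Classical (em : ExcludedMiddle (lsuc 0ℓ)) where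

  em₀ : {P : Set} → Dec P
  em₀ = map′ lower lift em

  ¬∀⇒∃¬ : {A : Set} {P : A → Set} → ¬ (∀ x → P x) → ∃[ x ] ¬ P x
  ¬∀⇒∃¬ ¬∀ = decidable-stable em₀ λ ¬∃ → ¬∀ λ x → decidable-stable em₀ λ ¬p → ¬∃ (x , ¬p)

  mutual
    ≰ₒ⇒>ₒ : ∀ α β → ¬ α ≤ₒ β → β <ₒ α
    ≰ₒ⇒>ₒ (sup⁺ f) β α≰β = let (i , fi≮β) = ¬∀⇒∃¬ α≰β in i , ≮ₒ⇒≥ₒ (f i) β fi≮β

    ≮ₒ⇒≥ₒ : ∀ α β → ¬ α <ₒ β → β ≤ₒ α
    ≮ₒ⇒≥ₒ α (sup⁺ g) α≮β j = ≰ₒ⇒>ₒ α (g j) λ α≤gj → α≮β (j , α≤gj)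

  ordView : ∀ α → OrdView α
  ordView α with em {∃[ β ] α ≈ₒ sucₒ β} | em₀ {α ≤ₒ zeroₒ}
  ... | yes (β , α≈) | _       = is-suc β α≈
  ... | no _         | yes α≤0 = is-zero (α≤0 , λ ())
  ... | no ¬suc      | no α≰0  = is-limit (≰ₒ⇒>ₒ α zeroₒ α≰0 , λ β β<α →
    -- If `sucₒ β` were not below `α`, then `α ≤ₒ sucₒ β`; together with `β <ₒ α` this would make
    -- `α` a successor.
    ≰ₒ⇒>ₒ α (sucₒ β) λ α≤ → ¬suc (β , α≤ , λ _ → β<α))

  least : (P : Pred Ord (lsuc 0ℓ)) → ∃ P → ∃[ α ] P α × (∀ β → P β → α ≤ₒ β)
  least P (α , pα) = go α pα (<ₒ-acc α)
    where
    go : ∀ α → P α → Acc _<ₒ_ α → ∃[ α ] P α × (∀ β → P β → α ≤ₒ β)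
    go α pα (acc rs) with em {∃[ β ] P β × β <ₒ α}
    ... | yes (β , pβ , β<α) = go β pβ (rs β<α)
    ... | no none            = α , pα , λ β pβ → ≮ₒ⇒≥ₒ β α λ β<α → none (β , pβ , β<α)

  sup∞ : (P : Pred Ord∞ (lsuc 0ℓ)) → ∃ (IsSup _≤∞_ P)
  sup∞ P with em {∃[ β ] (∀ s → P s → s ≤∞ [ β ])}
  ... | yes bounded = let (β , ub , β≤) = least (λ β → ∀ s → P s → s ≤∞ [ β ]) bounded in
    [ β ] , (λ {s} → ub s) ,
    λ { {[ γ ]} ubγ → [ β≤ γ (λ _ ps → ubγ ps) ]≤ ; {⊤⁺} _ → [ β ] ≤⊤⁺ }
  ... | no unbounded = ⊤⁺ , (λ {s} _ → s ≤⊤⁺) ,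
    λ { {[ γ ]} ubγ → contradiction (γ , λ _ ps → ubγ ps) unbounded ; {⊤⁺} _ → ⊤⁺ ≤⊤⁺ }

  -- The rank -1 contributes to the supremum only when no other rank occurs; the empty family also
  -- gets -1.
  supᵣ : (P : Pred Rank (lsuc 0ℓ)) → ∃ (IsSup _≤ᵣ_ P)
  supᵣ P with em {∃[ x ] P [ x ]₋}
  ... | no none = ⊥₋ ,
    (λ { {⊥₋} _ → ⊥₋≤ _ ; {[ x ]₋} px → contradiction (x , px) none }) , λ _ → ⊥₋≤ _
  ... | yes (x , px) = let (σ , ub , σ≤) = sup∞ (λ y → P [ y ]₋) in
    [ σ ]₋ , (λ { {⊥₋} _ → ⊥₋≤ _ ; {[ y ]₋} py → [ ub py ]≤₋ }) ,
    λ { {⊥₋} b → case-⊥₋ (b px)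
      ; {[ y ]₋} b → [ σ≤ (λ pz → Inf.[≤]-injective _≤∞_ (b pz)) ]≤₋ }
    where
    case-⊥₋ : ∀ {y} {A : Set₁} → [ y ]₋ ≤ᵣ ⊥₋ → A
    case-⊥₋ ()

  module _ {S : ℕ → Pred (List Bool) 0ℓ} {ι : ℕ} where

    -- Induction on the smaller ordinal `β`, since the shape of `β` decides which clause has to be
    -- produced.
    ndrk≥-mono : ∀ β → Acc _<ₒ_ β → (m : 𝐌 S ι) → ∀ α → β ≤ₒ α → Ndrk≥ m α → Ndrk≥ m β
    ndrk≥-mono β (acc rs) m α β≤α nd with ordView β
    ... | is-zero β≈0 = at-zero β≈0
    ... | is-limit lim = at-limit lim λ γ γ<β →
      ndrk≥-mono γ (rs γ<β) m α (≤ₒ-trans γ β α (<ₒ⇒≤ₒ γ β γ<β) β≤α) nd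
    ... | is-suc δ β≈@(β≤ , δ<β) = below nd
      where
      δ<α : δ <ₒ α
      δ<α = <ₒ-≤ₒ-trans δ β α (δ<β _) β≤α

      below : Ndrk≥ m α → Ndrk≥ m β
      below (at-zero (α≤0 , _)) = contradiction (<ₒ-≤ₒ-trans δ α zeroₒ δ<α α≤0) λ ()
      -- A limit above `δ` is also above `sucₒ δ`, hence above `β`.
      below (at-limit (_ , lim) nds) = nds β (≤ₒ-<ₒ-trans β (sucₒ δ) α β≤ (lim δ δ<α))
      below (at-suc γ (α≤ , _) ext) = at-suc δ β≈ λ ν ν∈ →
        let (n , l< , m⊑n , ndn , two) = ext ν ν∈
        in n , l< , m⊑n ,
           ndrk≥-mono δ (rs (δ<β _)) n γ (proj₂ (<ₒ-≤ₒ-trans δ α (sucₒ γ) δ<α α≤)) ndn , two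

    -- The least ordinal at which the lower bound fails can be neither zero nor a limit, and its
    -- predecessor is the rank.
    ndrk-exists : (m : 𝐌 S ι) → ∃ (HasNdrk m)
    ndrk-exists m with em {∃[ α ] ¬ Ndrk≥ m α}
    ... | no none = ⊤⁺ , infinite λ α → decidable-stable em λ ¬nd → none (α , ¬nd)
    ... | yes some with least (λ α → ¬ Ndrk≥ m α) some
    ...   | α , ¬nd , α≤ = rank (ordView α)
      where
      nd< : ∀ β → β <ₒ α → Ndrk≥ m β
      nd< β β<α = decidable-stable em λ ¬ndβ →
        <ₒ-irrefl β (<ₒ-≤ₒ-trans β α β β<α (α≤ β ¬ndβ))

      rank : OrdView α → ∃ (HasNdrk m)
      rank (is-zero α≈0) = contradiction (at-zero α≈0) ¬nd
      rank (is-limit lim) = contradiction (at-limit lim nd<) ¬nd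
      rank (is-suc β (α≤suc , β<α)) = [ β ] , ordinal (nd< β (β<α _))
        λ nd → ¬nd (ndrk≥-mono α (<ₒ-acc α) m (sucₒ β) α≤suc nd)

    -- The supremum is taken over the ranks plus one, so an ordinal value is a strict bound and
    -- rules out rank ∞.
    NDRK-bound : ∀ {s} → HasNDRK S ι [ s ] → (m : 𝐌 S ι) → ¬ Ndrk≥ m s
    NDRK-bound {s} (ub , _) m nd with ndrk-exists m
    ... | r , has = absurd has (ub (m , r , has , refl))
      where
      absurd : ∀ {r} → HasNdrk m r → suc∞ r ≤∞ [ s ] → ⊥
      absurd (ordinal {α} _ ¬nd) [ α<s ]≤ = ¬nd (ndrk≥-mono (sucₒ α) (<ₒ-acc _) m s α<s nd)
      absurd (infinite _) ()

-- Finite approximations of infinite sequences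

pre : ∀ l → Cantor → Vec Bool l
pre zero    x = []
pre (suc l) x = x 0 ∷ pre l (x ∘ suc)

pre-cong : ∀ l {x y} → (∀ {j} → j < l → x j ≡ y j) → pre l x ≡ pre l y
pre-cong zero    x≡y = refl
pre-cong (suc l) x≡y = cong₂ _∷_ (x≡y (s≤s z≤n)) (pre-cong l λ j<l → x≡y (s≤s j<l))

pre-injective : ∀ l {x y} → pre l x ≡ pre l y → ∀ {j} → j < l → x j ≡ y j
pre-injective (suc l) eq {zero}  _         = proj₁ (∷-injective eq)
pre-injective (suc l) eq {suc j} (s≤s j<l) = pre-injective l (proj₂ (∷-injective eq)) j<l

pre-+ : ∀ l x y → pre l (x +ᶜ y) ≡ pre l x +ᵛ pre l y
pre-+ zero    x y = refl
pre-+ (suc l) x y = cong (_ ∷_) (pre-+ l (x ∘ suc) (y ∘ suc))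

truncate-pre : ∀ {l l′} (l≤l′ : l ≤ l′) x → truncate l≤l′ (pre l′ x) ≡ pre l x
truncate-pre z≤n       x = refl
truncate-pre (s≤s le) x = cong (x 0 ∷_) (truncate-pre le (x ∘ suc))

toList-pre : ∀ l x → toList (pre l x) ≡ applyUpTo x l
toList-pre zero    x = refl
toList-pre (suc l) x = cong (x 0 List.∷_) (toList-pre l (x ∘ suc))

pre-◁ : ∀ {l l′} → l < l′ → ∀ {x y} → pre l x ≡ pre l y → toList (pre l x) ◁ toList (pre l′ y)
pre-◁ {l} {l′} l<l′ {x} {y} eq = prefix (ℕ.<⇒≤ l<l′) eq , λ same →
  ℕ.<⇒≢ l<l′ (trans (sym (length-toList (pre l x))) (trans (cong length same) (length-toList (pre l′ y))))
  where
  prefix : ∀ {l l′} → l ≤ l′ → ∀ {x y} → pre l x ≡ pre l y →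
           Prefix _≡_ (toList (pre l x)) (toList (pre l′ y))
  prefix z≤n      eq = []
  prefix (s≤s le) eq = proj₁ (∷-injective eq) ∷ prefix le (proj₂ (∷-injective eq))

atLeast2 : ∀ {a ℓ} {S : Setoid a ℓ} (x y : Setoid.Carrier S) → ¬ Setoid._≈_ S x y → AtLeast 2 S
atLeast2 {S = S} x y x≉y = record
  { to = to ; cong = λ { refl → Setoid.refl S } ; injective = λ {i} {j} → inj i j }
  where
  to : Fin 2 → Setoid.Carrier S
  to zero = x
  to (suc zero) = y

  inj : ∀ i j → Setoid._≈_ S (to i) (to j) → i ≡ j
  inj zero       zero       _  = refl
  inj zero       (suc zero) eq = contradiction eq x≉y
  inj (suc zero) zero       eq = contradiction (Setoid.sym S eq) x≉y
  inj (suc zero) (suc zero) _  = refl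

-- Properties that hold from some level on

Eventually : (ℕ → Set) → Set
Eventually P = ∃[ N ] (∀ n → N ≤ n → P n)

eventually-× : ∀ {P Q} → Eventually P → Eventually Q → Eventually (λ n → P n × Q n)
eventually-× (M , p) (N , q) = M ⊔ N , λ n le →
  p n (ℕ.≤-trans (ℕ.m≤m⊔n M N) le) , q n (ℕ.≤-trans (ℕ.m≤n⊔m M N) le)

eventually-map : ∀ {P Q : ℕ → Set} → (∀ {n} → P n → Q n) → Eventually P → Eventually Q
eventually-map f (N , p) = N , λ n le → f (p n le)

eventually-Fin : ∀ k {P : Fin k → ℕ → Set} → (∀ i → Eventually (P i)) → Eventually (λ n → ∀ i → P i n)
eventually-Fin zero    ev = 0 , λ _ _ ()
eventually-Fin (suc k) ev = eventually-map (λ { (p , q) zero → p ; (p , q) (suc i) → q i })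
  (eventually-× (ev zero) (eventually-Fin k (ev ∘ suc)))

eventually-⊎ : ∀ k {P : Fin k ⊎ Fin k → ℕ → Set} → (∀ s → Eventually (P s)) → Eventually (λ n → ∀ s → P s n)
eventually-⊎ k ev = eventually-map (λ { (p , q) (inj₁ i) → p i ; (p , q) (inj₂ i) → q i })
  (eventually-× (eventually-Fin k (ev ∘ inj₁)) (eventually-Fin k (ev ∘ inj₂)))

-- The lexicographic order on the Cantor space

infix 4 _≺_

_≺_ : Cantor → Cantor → Set
x ≺ y = ∃[ c ] (∀ {j} → j < c → x j ≡ y j) × (x c ≡ false) × (y c ≡ true)

≺-asym : ∀ {x y} → x ≺ y → ¬ y ≺ x
≺-asym (c , same , xc , yc) (d , same′ , yd , xd) with ℕ.<-cmp c d
... | tri< c<d _ _  = contradiction (trans (sym yc) (trans (same′ c<d) xc)) λ ()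
... | tri≈ _ refl _ = contradiction (trans (sym yc) yd) λ ()
... | tri> _ _ d<c  = contradiction (trans (sym xd) (trans (same d<c) yd)) λ ()

agree-suc : ∀ {x y : Cantor} {n} → (∀ {j} → j < n → x j ≡ y j) → x n ≡ y n →
            ∀ {j} → j < suc n → x j ≡ y j
agree-suc same eq j< with ℕ.m<1+n⇒m<n∨m≡n j<
... | inj₁ j<n  = same j<n
... | inj₂ refl = eq

-- A search for the first difference below `n`; agreement so far is carried along because `≺`
-- requires it.
≺-total-at : ∀ x y n → (∀ {j} → j < n → x j ≡ y j) ⊎ (x ≺ y ⊎ y ≺ x)
≺-total-at x y zero = inj₁ λ ()
≺-total-at x y (suc n) with ≺-total-at x y n
... | inj₂ cmp = inj₂ cmp
... | inj₁ same with x n in xn | y n in yn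
...   | false | true  = inj₂ (inj₁ (n , same , xn , yn))
...   | true  | false = inj₂ (inj₂ (n , (λ j<n → sym (same j<n)) , yn , xn))
...   | false | false = inj₁ (agree-suc same (trans xn (sym yn)))
...   | true  | true  = inj₁ (agree-suc same (trans xn (sym yn)))

≺-total : ∀ {x y n} → x n ≢ y n → x ≺ y ⊎ y ≺ x
≺-total {x} {y} {n} xn≢yn with ≺-total-at x y (suc n)
... | inj₁ same = contradiction (same ℕ.≤-refl) xn≢yn
... | inj₂ cmp  = cmp

-- Overlapping translations

Monochromatic : ∀ {n} → (Fin n → Bool) → ℕ → Bool → Set
Monochromatic {n} f k v = Σ (Fin k → Fin n) λ e → Injective _≡_ _≡_ e × (∀ i → f (e i) ≡ v)

module _ {n : ℕ} (f : Fin (suc n) → Bool) {k : ℕ} {v : Bool} where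

  mono-skip : Monochromatic (f ∘ suc) k v → Monochromatic f k v
  mono-skip (e , inj , mono) = (suc ∘ e) , (λ eq → inj (suc-injective eq)) , mono

  mono-add : f zero ≡ v → Monochromatic (f ∘ suc) k v → Monochromatic f (suc k) v
  mono-add f0 (e , inj , mono) =
    (λ { zero → zero ; (suc i) → suc (e i) }) ,
    (λ { {zero} {zero} _ → refl ; {suc i} {suc j} eq → cong suc (inj (suc-injective eq)) }) ,
    λ { zero → f0 ; (suc i) → mono i }

pigeonhole-2 : ∀ n p q → n ≡ p + q → (f : Fin n → Bool) → Monochromatic f p true ⊎ Monochromatic f q false
pigeonhole-2 n zero q eq f = inj₁ ((λ ()) , (λ { {()} }) , λ ())
pigeonhole-2 n (suc p) zero eq f = inj₂ ((λ ()) , (λ { {()} }) , λ ())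
pigeonhole-2 (suc n) (suc p) (suc q) eq f with f zero in f0
... | true  = Sum.map (mono-add f f0) (mono-skip f) (pigeonhole-2 n p (suc q) (ℕ.suc-injective eq) (f ∘ suc))
... | false = Sum.map (mono-skip f) (mono-add f f0)
  (pigeonhole-2 n (suc p) q (trans (ℕ.suc-injective eq) (ℕ.+-suc p q)) (f ∘ suc))

-- The infinite form of clauses (iii) to (v) for a single pair of points: cutting all sequences at a
-- high enough level gives the finite clauses.
record Overlap (S : ℕ → Pred (List Bool) 0ℓ) {ι : ℕ} (x y : Cantor)
               (h h′ : Fin ι → ℕ) (g g′ : Fin ι → Cantor) : Set where
  field
    g∈       : ∀ i → lim (S (h i)) (g i)
    g′∈      : ∀ i → lim (S (h′ i)) (g′ i)
    balanced : ∀ i → x +ᶜ g i ≗ y +ᶜ g′ i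
    separated : ∀ s t → Sum.[ g , g′ ]′ s ≗ Sum.[ g , g′ ]′ t → s ≡ t

-- The conditions are symmetric, so common points chosen for one orientation of a pair also serve
-- the other.
overlap-flip : ∀ {S ι x y} {h h′ : Fin ι → ℕ} {g g′} → Overlap S x y h h′ g g′ → Overlap S y x h′ h g′ g
overlap-flip o = record
  { g∈       = g′∈
  ; g′∈      = g∈
  ; balanced = λ i n → sym (balanced i n)
  ; separated = λ
    { (inj₁ i) (inj₁ j) eq → cong Sum.swap (separated (inj₂ i) (inj₂ j) eq)
    ; (inj₁ i) (inj₂ j) eq → cong Sum.swap (separated (inj₂ i) (inj₁ j) eq)
    ; (inj₂ i) (inj₁ j) eq → cong Sum.swap (separated (inj₁ i) (inj₂ j) eq)
    ; (inj₂ i) (inj₂ j) eq → cong Sum.swap (separated (inj₁ i) (inj₁ j) eq) }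
  } where open Overlap o

record OverlapWitness (S : ℕ → Pred (List Bool) 0ℓ) (ι : ℕ) (x y : Cantor) : Set where
  field
    h h′ : Fin ι → ℕ
    g g′ : Fin ι → Cantor
    overlaps : Overlap S x y h h′ g g′

xor-cancelʳ : ∀ a {b c} → a xor b ≡ a xor c → b ≡ c
xor-cancelʳ false eq = eq
xor-cancelʳ true {false} {false} _ = refl
xor-cancelʳ true {true}  {true}  _ = refl

-- Let x and y differ at c.  If z = g + x = g′ + y for two points z with the
-- same c-th digit, then no g can equal any g′, since they differ at c; by the
-- pigeonhole principle ι of the 2ι common points have the same c-th digit.
overlap-exists : ∀ {S} ι {x y : Cantor} {c} → x c ≢ y c →
  AtLeast (2 * ι) (Subsetoid Cantorₛ ((⋃lim S +ˢ x) ∩ (⋃lim S +ˢ y))) → OverlapWitness S ι x y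
overlap-exists {S} ι {x} {y} {c} xc≢yc many = choose
  (pigeonhole-2 (2 * ι) ι ι (cong (ι +_) (ℕ.+-identityʳ ι)) (λ k → proj₁ (to k) c))
  where
  open Injection many using (to; injective)

  choose-mono : ∀ {v} → Monochromatic (λ k → proj₁ (to k) c) ι v → OverlapWitness S ι x y
  choose-mono {v} (e , e-inj , mono) = record
    { h = λ i → proj₁ (proj₁ (proj₂ (inX i)))
    ; h′ = λ i → proj₁ (proj₁ (proj₂ (inY i)))
    ; g = g
    ; g′ = g′
    ; overlaps = record
      { g∈ = λ i → proj₂ (proj₁ (proj₂ (inX i)))
      ; g′∈ = λ i → proj₂ (proj₁ (proj₂ (inY i)))
      ; balanced = λ i n → begin
          x n xor g i n   ≡⟨ xor-comm (x n) (g i n) ⟩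
          g i n xor x n   ≡⟨ z≗g i n ⟨
          z i n           ≡⟨ z≗g′ i n ⟩
          g′ i n xor y n  ≡⟨ xor-comm (g′ i n) (y n) ⟩
          y n xor g′ i n  ∎
      ; separated = λ
        { (inj₁ i) (inj₁ j) eq → cong inj₁ (e-inj (injective λ n →
            trans (z≗g i n) (trans (cong (_xor x n) (eq n)) (sym (z≗g j n)))))
        ; (inj₁ i) (inj₂ j) eq → contradiction (eq c) (g≢g′ i j)
        ; (inj₂ i) (inj₁ j) eq → contradiction (sym (eq c)) (g≢g′ j i)
        ; (inj₂ i) (inj₂ j) eq → cong inj₂ (e-inj (injective λ n →
            trans (z≗g′ i n) (trans (cong (_xor y n) (eq n)) (sym (z≗g′ j n))))) }
      }
    }
    where
    open ≡-Reasoning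
    z : Fin ι → Cantor
    z i = proj₁ (to (e i))

    inX : ∀ i → (⋃lim S +ˢ x) (z i)
    inX i = proj₁ (proj₂ (to (e i)))

    inY : ∀ i → (⋃lim S +ˢ y) (z i)
    inY i = proj₂ (proj₂ (to (e i)))

    g g′ : Fin ι → Cantor
    g i = proj₁ (inX i)
    g′ i = proj₁ (inY i)

    z≗g : ∀ i → z i ≗ g i +ᶜ x
    z≗g i = proj₂ (proj₂ (inX i))

    z≗g′ : ∀ i → z i ≗ g′ i +ᶜ y
    z≗g′ i = proj₂ (proj₂ (inY i))

    g≢g′ : ∀ i j → g i c ≢ g′ j c
    g≢g′ i j eq = xc≢yc (xor-cancelʳ (g i c) (begin
      g i c xor x c   ≡⟨ z≗g i c ⟨
      z i c           ≡⟨ mono i ⟩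
      v               ≡⟨ mono j ⟨
      z j c           ≡⟨ z≗g′ j c ⟩
      g′ j c xor y c  ≡⟨ cong (_xor y c) eq ⟨
      g i c xor y c   ∎))

  choose : Monochromatic (λ k → proj₁ (to k) c) ι true ⊎ Monochromatic (λ k → proj₁ (to k) c) ι false →
           OverlapWitness S ι x y
  choose = Sum.[ choose-mono , choose-mono ]

-- Symbols are coded in bijective base 2, writing each number in unary.

unary : ℕ → ℕᵇ → ℕᵇ
unary zero    r = 1+[2 r ]
unary (suc n) r = 2[1+ unary n r ]

unary-injective : ∀ m n {r s} → unary m r ≡ unary n s → (m ≡ n) × (r ≡ s)
unary-injective zero    zero    refl = refl , refl
unary-injective (suc m) (suc n) eq   with unary-injective m n (ℕᵇ.2[1+_]-injective eq)
... | refl , r≡s = refl , r≡s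

digit : Bool → ℕᵇ → ℕᵇ
digit false r = 1+[2 r ]
digit true  r = 2[1+ r ]

digit-injective : ∀ b c {r s} → digit b r ≡ digit c s → (b ≡ c) × (r ≡ s)
digit-injective false false refl = refl , refl
digit-injective true  true  refl = refl , refl

-- In the model, `(i , n , j , b , c)` says of a pair that its `i`-th `h` is `n`, that digit `j` of
-- the first point is `b`, and that digit `j` of the `i`-th `g` is `c`.
Symbol : ℕ → Set
Symbol ι = Fin ι × ℕ × ℕ × Bool × Bool

code : ∀ {ι} → Symbol ι → ℕᵇ
code (i , n , j , b , c) = unary (toℕ i) (unary n (unary j (digit b (digit c ℕᵇ.zero))))

code-injective : ∀ {ι} (s t : Symbol ι) → code s ≡ code t → s ≡ t
code-injective (i , n , j , b , c) (i′ , n′ , j′ , b′ , c′) eq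
  with unary-injective (toℕ i) (toℕ i′) eq
... | i≡ , eq₁ with toℕ-injective i≡ | unary-injective n n′ eq₁
... | refl | refl , eq₂ with unary-injective j j′ eq₂
... | refl , eq₃ with digit-injective b b′ eq₃
... | refl , eq₄ with digit-injective c c′ eq₄
... | refl , _ = refl

binary : ℕ → Vocabulary
binary ι = record
  { RelSym = Symbol ι
  ; FunSym = ⊥
  ; relArity = λ _ → 2
  ; funArity = λ ()
  ; countable = record
    { to = λ { (inj₁ s) → ℕᵇ.toℕ (code s) }
    ; cong = λ { refl → refl }
    ; injective = λ { {inj₁ s} {inj₁ t} eq → cong inj₁ (code-injective s t (ℕᵇ.toℕ-injective eq)) }
    }
  }

-- At least one variable is demanded so that the empty conjunction can be a true equation.
conj : ∀ {τ n} k → (Fin k → QFFormula τ (suc n)) → QFFormula τ (suc n)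
conj zero    φ = equal (var zero) (var zero)
conj (suc k) φ = and (φ zero) (conj k (φ ∘ suc))

module _ {τ : Vocabulary} {Λ : Set} (M : Model τ Λ) {n : ℕ} (w : Vec Λ (suc n)) where

  conj-intro : ∀ k (φ : Fin k → QFFormula τ (suc n)) → (∀ i → Sat M (φ i) w) → Sat M (conj k φ) w
  conj-intro zero    φ sat = refl
  conj-intro (suc k) φ sat = sat zero , conj-intro k (φ ∘ suc) (sat ∘ suc)

  conj-elim : ∀ k (φ : Fin k → QFFormula τ (suc n)) → Sat M (conj k φ) w → ∀ i → Sat M (φ i) w
  conj-elim (suc k) φ (s , _)   zero    = s
  conj-elim (suc k) φ (_ , sat) (suc i) = conj-elim k (φ ∘ suc) sat i

-- Finite tuples of points and the elements of 𝐌 cut from them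

module Configurations
  (em : ExcludedMiddle (lsuc 0ℓ)) (S : ℕ → Pred (List Bool) 0ℓ) {ι : ℕ} (0<ι : 0 < ι) {Λ : Set}
  (η : Λ → Cantor) (η-injective : ∀ {a b} → η a ≗ η b → a ≡ b)
  (h : Λ → Λ → Fin ι → ℕ) (g : Λ → Λ → Fin ι → Cantor)
  (overlaps : ∀ {a b} → a ≢ b → Overlap S (η a) (η b) (h a b) (h b a) (g a b) (g b a))
  where

  open Classical em

  gg : Λ → Λ → Fin ι ⊎ Fin ι → Cantor
  gg a b = Sum.[ g a b , g b a ]′

  -- At such a level cutting keeps the points distinct and preserves clause (v). The second demand
  -- excludes `p ≡ q`, where nothing is known about the data.
  record Separates {n} (w : Vec Λ n) (l : ℕ) : Set where
    field
      0<l : 0 < l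
      η-separated : ∀ p q → pre l (η (lookup w p)) ≡ pre l (η (lookup w q)) → p ≡ q
      g-separated : ∀ p q → p ≢ q → ∀ s t →
        pre l (gg (lookup w p) (lookup w q) s) ≡ pre l (gg (lookup w p) (lookup w q) t) → s ≡ t

  -- Either the sequences agree and `Q` holds outright, or they differ at some digit and every level
  -- beyond it refutes the premise.
  eventually-separated : ∀ x y {Q : Set} → (x ≗ y → Q) → Eventually (λ l → pre l x ≡ pre l y → Q)
  eventually-separated x y {Q} f with em₀ {x ≗ y}
  ... | yes x≗y = 0 , λ _ _ _ → f x≗y
  ... | no x≇y = let (j , xj≢yj) = ¬∀⇒∃¬ x≇y in
    suc j , λ l j<l eq → contradiction (pre-injective l eq j<l) xj≢yj

  separates-beyond : ∀ {n} {w : Vec Λ n} → Unique w → ∀ l → ∃[ l′ ] (l < l′) × Separates w l′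
  separates-beyond {n} {w} unique l =
    let (N , sep) = eventually-× sepη sepg
        -- The maximum reaches the threshold `N`; the successor makes the level positive and
        -- strictly larger than `l`.
        l′ = suc (l ⊔ N)
        (sη , sg) = sep l′ (ℕ.m≤n⇒m≤1+n (ℕ.m≤n⊔m l N))
    in l′ , s≤s (ℕ.m≤m⊔n l N) , record { 0<l = s≤s z≤n ; η-separated = sη ; g-separated = sg }
    where
    sepη : Eventually (λ l → ∀ p q → pre l (η (lookup w p)) ≡ pre l (η (lookup w q)) → p ≡ q)
    sepη = eventually-Fin n λ p → eventually-Fin n λ q →
      eventually-separated _ _ λ eq → lookup-injective unique p q (η-injective eq)

    sepg : Eventually (λ l → ∀ p q → p ≢ q → ∀ s t →
      pre l (gg (lookup w p) (lookup w q) s) ≡ pre l (gg (lookup w p) (lookup w q) t) → s ≡ t)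
    sepg = eventually-Fin n λ p → eventually-Fin n λ q → atPair p q em₀
      where
      atPair : ∀ p q → Dec (p ≡ q) → Eventually (λ l → p ≢ q → ∀ s t →
        pre l (gg (lookup w p) (lookup w q) s) ≡ pre l (gg (lookup w p) (lookup w q) t) → s ≡ t)
      atPair p q (yes p≡q) = 0 , λ _ _ p≢q → contradiction p≡q p≢q
      atPair p q (no p≢q)  = eventually-map (λ sep _ → sep)
        (eventually-⊎ ι λ s → eventually-⊎ ι λ t → eventually-separated _ _ λ eq →
          Overlap.separated (overlaps λ wp≡wq → p≢q (lookup-injective unique p q wp≡wq)) s t eq)

  module Realisation {n : ℕ} (w : Vec Λ n) (l : ℕ) (sep : Separates w l) where

    open Separates sep

    pη : Fin n → Vec Bool l
    pη p = pre l (η (lookup w p))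

    search : ∀ σ → Dec (∃[ p ] σ ≡ pη p)
    search σ = any? λ p → ≡-dec Bool._≟_ σ (pη p)

    u : FinSubset l
    u σ = ⌊ search σ ⌋

    pη∈u : ∀ p → pη p ∈ᵤ u
    pη∈u p = fromWitness (p , refl)

    -- Membership proofs in `u ⟨2⟩` are irrelevant, so the position is recomputed from the decision
    -- `search σ`. Hence `hᵤ` and `gᵤ` depend only on the sequences.
    locate : ∀ σ → .(σ ∈ᵤ u) → ∃[ p ] σ ≡ pη p
    locate σ σ∈ = recompute (search σ) (toWitness σ∈)

    at : ∀ σ → .(σ ∈ᵤ u) → Λ
    at σ σ∈ = lookup w (proj₁ (locate σ σ∈))

    locate-unique : ∀ {σ} .(σ∈ : σ ∈ᵤ u) {p} → σ ≡ pη p → at σ σ∈ ≡ lookup w p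
    locate-unique {σ} σ∈ {p} eq = cong (lookup w)
      (η-separated _ _ (trans (sym (proj₂ (locate σ σ∈))) eq))

    located-≢ : ∀ {σ τ} .(σ∈ : σ ∈ᵤ u) .(τ∈ : τ ∈ᵤ u) → .(σ ≢ τ) →
                proj₁ (locate σ σ∈) ≢ proj₁ (locate τ τ∈)
    located-≢ {σ} {τ} σ∈ τ∈ σ≢τ eq = ⊥-elim-irr
      (σ≢τ (trans (proj₂ (locate σ σ∈)) (trans (cong pη eq) (sym (proj₂ (locate τ τ∈))))))

    lookup-≢ : ∀ {p q} → p ≢ q → lookup w p ≢ lookup w q
    lookup-≢ p≢q eq = p≢q (η-separated _ _ (cong (pre l ∘ η) eq))

    hᵤ : Fin ι → u ⟨2⟩ → ℕ
    hᵤ i (pair σ τ σ∈ τ∈ _) = h (at σ σ∈) (at τ τ∈) i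

    gᵤ : Fin ι → u ⟨2⟩ → Vec Bool l
    gᵤ i (pair σ τ σ∈ τ∈ _) = pre l (g (at σ σ∈) (at τ τ∈) i)

    gᵤ∈ : ∀ i q → S (hᵤ i q) (toList (gᵤ i q))
    gᵤ∈ i (pair σ τ σ∈ τ∈ σ≢τ) = subst (S _) (sym (toList-pre l _))
      (Overlap.g∈ (overlaps (lookup-≢ (located-≢ σ∈ τ∈ σ≢τ))) i l)

    balancedᵤ : ∀ i q → left q +ᵛ gᵤ i q ≡ right q +ᵛ gᵤ i (swap q)
    balancedᵤ i (pair σ τ σ∈ τ∈ σ≢τ) = begin
      σ +ᵛ pre l (g a b i)            ≡⟨ cong (_+ᵛ pre l (g a b i)) (proj₂ (locate σ σ∈)) ⟩
      pre l (η a) +ᵛ pre l (g a b i)  ≡⟨ pre-+ l (η a) (g a b i) ⟨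
      pre l (η a +ᶜ g a b i)          ≡⟨ pre-cong l (λ {j} _ →
        Overlap.balanced (overlaps (lookup-≢ (located-≢ σ∈ τ∈ σ≢τ))) i j) ⟩
      pre l (η b +ᶜ g b a i)          ≡⟨ pre-+ l (η b) (g b a i) ⟩
      pre l (η b) +ᵛ pre l (g b a i)  ≡⟨ cong (_+ᵛ pre l (g b a i)) (proj₂ (locate τ τ∈)) ⟨
      τ +ᵛ pre l (g b a i)            ∎
      where
      open ≡-Reasoning
      a = at σ σ∈
      b = at τ τ∈

    distinctᵤ : ∀ q → Injective {A = Fin ι ⊎ Fin ι} _≡_ _≡_ Sum.[ (λ i → gᵤ i q) , (λ i → gᵤ i (swap q)) ]
    distinctᵤ (pair σ τ σ∈ τ∈ σ≢τ) {s} {t} eq =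
      g-separated _ _ (located-≢ σ∈ τ∈ σ≢τ) s t (trans (sym (expand s)) (trans eq (expand t)))
      where
      expand : ∀ s → Sum.[ (λ i → gᵤ i (pair σ τ σ∈ τ∈ σ≢τ)) , (λ i → gᵤ i (swap (pair σ τ σ∈ τ∈ σ≢τ))) ] s
                     ≡ pre l (gg (at σ σ∈) (at τ τ∈) s)
      expand (inj₁ i) = refl
      expand (inj₂ i) = refl

  realise : ∀ {n} (w : Vec Λ (suc (suc n))) l → Separates w l → 𝐌 S ι
  realise w l sep = record
    { len = l
    ; u = u
    ; h = hᵤ
    ; g = gᵤ
    ; 0<len = Separates.0<l sep
    ; 2≤∣u∣ = atLeast2 (pη zero , pη∈u zero) (pη (suc zero) , pη∈u (suc zero)) λ eq →
        contradiction (Separates.η-separated sep zero (suc zero) eq) λ ()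
    ; g∈ = gᵤ∈
    ; balanced = balancedᵤ
    ; distinct-g = distinctᵤ
    } where open Realisation w l sep

  -- The model on Λ and the diagrams of its finite tuples

  model : Model (binary ι) Λ
  model = record
    { relI = λ { (i , n , j , b , c) (x ∷ y ∷ []) → (h x y i ≡ n) × (η x j ≡ b) × (g x y i j ≡ c) }
    ; funI = λ ()
    }

  module Diagram {n : ℕ} (w : Vec Λ (suc n)) (l : ℕ) where

    -- The values of `h`, `η` and `g` at `w` enter only through the choice of the symbol, so other
    -- tuples can satisfy the same formula.
    digitφ : ∀ (p q : Fin (suc n)) (i : Fin ι) → Fin l → QFFormula (binary ι) (suc n)
    digitφ p q i j = rel
      ( i , h (lookup w p) (lookup w q) i , toℕ j , η (lookup w p) (toℕ j)
      , g (lookup w p) (lookup w q) i (toℕ j) ) (var p ∷ var q ∷ [])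

    wordφ : ∀ (p q : Fin (suc n)) → Fin ι → QFFormula (binary ι) (suc n)
    wordφ p q i = conj l (digitφ p q i)

    pairφ : ∀ (p q : Fin (suc n)) → QFFormula (binary ι) (suc n)
    pairφ p q = conj ι (wordφ p q)

    pointφ : Fin (suc n) → QFFormula (binary ι) (suc n)
    pointφ p = conj (suc n) (pairφ p)

    diagram : QFFormula (binary ι) (suc n)
    diagram = conj (suc n) pointφ

    diagram-intro : ∀ v → (∀ p q i j → Sat model (digitφ p q i j) v) → Sat model diagram v
    diagram-intro v sat = conj-intro model v (suc n) pointφ λ p → conj-intro model v (suc n) (pairφ p) λ q →
      conj-intro model v ι (wordφ p q) λ i → conj-intro model v l (digitφ p q i) (sat p q i)

    diagram-elim : ∀ v → Sat model diagram v → ∀ p q i j → Sat model (digitφ p q i j) v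
    diagram-elim v sat p q i = conj-elim model v l (digitφ p q i) (conj-elim model v ι (wordφ p q)
      (conj-elim model v (suc n) (pairφ p) (conj-elim model v (suc n) pointφ sat p) q) i)

  open Diagram using (diagram; diagram-intro; diagram-elim)

  diagram-self : ∀ {n} (w : Vec Λ (suc n)) l → Sat model (diagram w l) w
  diagram-self w l = diagram-intro w l w λ _ _ _ _ → refl , refl , refl

  record Agree {n} (l : ℕ) (v w : Vec Λ n) : Set where
    field
      η-agree : ∀ p → pre l (η (lookup v p)) ≡ pre l (η (lookup w p))
      h-agree : ∀ p q i → h (lookup v p) (lookup v q) i ≡ h (lookup w p) (lookup w q) i
      g-agree : ∀ p q i → pre l (g (lookup v p) (lookup v q) i) ≡ pre l (g (lookup w p) (lookup w q) i)

  diagram-agree : ∀ {n} (w v : Vec Λ (suc n)) l → 0 < l → Sat model (diagram w l) v → Agree l v w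
  diagram-agree {n} w v l 0<l sat = record
    -- The digits of a single point are read off a symbol for the pair `p , p`; some index below `ι`
    -- is needed to name one.
    { η-agree = λ p → pre-cong l λ j<l → proj₁ (proj₂ (digits p p (fromℕ< 0<ι) j<l))
    -- Every symbol also fixes a digit position, so reading `h` takes at least one position below
    -- `l`.
    ; h-agree = λ p q i → proj₁ (digits p q i 0<l)
    ; g-agree = λ p q i → pre-cong l λ j<l → proj₂ (proj₂ (digits p q i j<l))
    }
    where
    digits : ∀ p q i {j} → j < l →
      (h (lookup v p) (lookup v q) i ≡ h (lookup w p) (lookup w q) i) ×
      (η (lookup v p) j ≡ η (lookup w p) j) ×
      (g (lookup v p) (lookup v q) i j ≡ g (lookup w p) (lookup w q) i j)
    digits p q i j<l with diagram-elim w l v sat p q i (fromℕ< j<l)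
    ... | eqs rewrite toℕ-fromℕ< j<l = eqs

  -- Adding one point yields an extension that splits a node

  module Extension {n : ℕ} {w : Vec Λ (suc (suc n))} {l : ℕ} (sep : Separates w l) {a : Λ} {l′ : ℕ} (l<l′ : l < l′)
    (sep′ : Separates (a ∷ w) l′) (j : Fin (suc (suc n))) (agree : Agree l (w [ j ]≔ a) w) where

    open Agree agree
    module R = Realisation w l sep
    module R′ = Realisation (a ∷ w) l′ sep′

    l≤l′ : l ≤ l′
    l≤l′ = ℕ.<⇒≤ l<l′

    -- Sends each point of `a ∷ w` to the old point with the same cut at `l`; the new point falls on
    -- the node of `j`, whose place it takes in the diagram.
    collapse : Fin (suc (suc (suc n))) → Fin (suc (suc n))
    collapse zero    = j
    collapse (suc p) = p

    η-new : pre l (η a) ≡ R.pη j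
    η-new = trans (cong (pre l ∘ η) (sym (lookup∘update j w a))) (η-agree j)

    η-collapse : ∀ p → pre l (η (lookup (a ∷ w) p)) ≡ R.pη (collapse p)
    η-collapse zero    = η-new
    η-collapse (suc p) = refl

    truncate-pη : ∀ p → truncate l≤l′ (R′.pη p) ≡ R.pη (collapse p)
    truncate-pη p = trans (truncate-pre l≤l′ _) (η-collapse p)

    -- Agreement of `w [ j ]≔ a` with `w` controls `a` against each old point other than the `j`-th.
    -- The remaining pair lies above a single node, where `⊑` imposes no condition on `h` and `g`.
    pair-collapse : ∀ p q → collapse p ≢ collapse q → ∀ i →
      let x = lookup (a ∷ w) p ; y = lookup (a ∷ w) q
          x′ = lookup w (collapse p) ; y′ = lookup w (collapse q)
      in (h x′ y′ i ≡ h x y i) × (pre l (g x′ y′ i) ≡ pre l (g x y i))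
    pair-collapse zero    zero    ne i = contradiction refl ne
    pair-collapse (suc p) (suc q) ne i = refl , refl
    pair-collapse zero    (suc q) ne i
      with h-agree j q i | g-agree j q i
    ... | eqh | eqg rewrite lookup∘update j w a | lookup∘update′ (ne ∘ sym) w a = sym eqh , sym eqg
    pair-collapse (suc p) zero    ne i
      with h-agree p j i | g-agree p j i
    ... | eqh | eqg rewrite lookup∘update j w a | lookup∘update′ ne w a = sym eqh , sym eqg

    u⇒ : ∀ {σ} → σ ∈ᵤ R.u → ∃[ τ ] (τ ∈ᵤ R′.u) × (σ ≡ truncate l≤l′ τ)
    u⇒ {σ} σ∈ = let (p , eq) = R.locate σ σ∈ in
      R′.pη (suc p) , R′.pη∈u (suc p) , trans eq (sym (truncate-pη (suc p)))

    locate-truncate : ∀ τ .(τ∈ : τ ∈ᵤ R′.u) →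
      truncate l≤l′ τ ≡ R.pη (collapse (proj₁ (R′.locate τ τ∈)))
    locate-truncate τ τ∈ = trans (cong (truncate l≤l′) (proj₂ (R′.locate τ τ∈)))
      (truncate-pη (proj₁ (R′.locate τ τ∈)))

    u⇐ : ∀ {σ} → (∃[ τ ] (τ ∈ᵤ R′.u) × (σ ≡ truncate l≤l′ τ)) → σ ∈ᵤ R.u
    u⇐ (τ , τ∈ , refl) = fromWitness (_ , locate-truncate τ τ∈)

    -- The two levels locate points by independent searches. Separation at `l` forces the point
    -- found there to be the collapse of the one found at `l′`, which reduces the claim to
    -- `pair-collapse`.
    restricted : ∀ i σ τ .(σ∈ : σ ∈ᵤ R′.u) .(τ∈ : τ ∈ᵤ R′.u) → truncate l≤l′ σ ≢ truncate l≤l′ τ →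
      let x = R.at (truncate l≤l′ σ) (u⇐ (σ , σ∈ , refl)) ; y = R.at (truncate l≤l′ τ) (u⇐ (τ , τ∈ , refl))
          x′ = R′.at σ σ∈ ; y′ = R′.at τ τ∈
      in (h x y i ≡ h x′ y′ i) × (pre l (g x y i) ≡ pre l (g x′ y′ i))
    restricted i σ τ σ∈ τ∈ ne
      rewrite R.locate-unique (u⇐ (σ , σ∈ , refl)) (locate-truncate σ σ∈)
            | R.locate-unique (u⇐ (τ , τ∈ , refl)) (locate-truncate τ τ∈)
      = pair-collapse (proj₁ (R′.locate σ σ∈)) (proj₁ (R′.locate τ τ∈)) (λ eq → ne (trans (locate-truncate σ σ∈)
          (trans (cong R.pη eq) (sym (locate-truncate τ τ∈))))) i

    extends : realise w l sep ⊑ realise (a ∷ w) l′ sep′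
    extends = record
      { len≤ = l≤l′
      ; u≐ = u⇒ , u⇐
      ; h≡ = λ { i (pair σ τ σ∈ τ∈ _) ne → proj₁ (restricted i σ τ σ∈ τ∈ ne) }
      ; g≡ = λ { i (pair σ τ σ∈ τ∈ _) ne →
          trans (proj₂ (restricted i σ τ σ∈ τ∈ ne)) (sym (truncate-pre l≤l′ _)) }
      }

    -- The two nodes above the `j`-th one come from the new point and the old `j`-th point, which
    -- `l′` separates.
    splits : AtLeast 2 (Subsetoid (setoid (Vec Bool l′))
                          (λ τ → (τ ∈ᵤ R′.u) × (toList (R.pη j) ◁ toList τ)))
    splits = atLeast2
      (R′.pη zero , R′.pη∈u zero , pre-◁ l<l′ (sym η-new))
      (R′.pη (suc j) , R′.pη∈u (suc j) , pre-◁ l<l′ refl)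
      λ eq → contradiction (Separates.η-separated sep′ zero (suc j) eq) λ ()

  -- Comparison of the model rank with the rank on 𝐌

  ∉⇒All≢ : ∀ {n a} (w : Vec Λ n) → a ∉ w → All (a ≢_) w
  ∉⇒All≢ []      a∉ = []
  ∉⇒All≢ (x ∷ w) a∉ = (a∉ ∘ here) ∷ ∉⇒All≢ w (a∉ ∘ there)

  -- The clauses of the two ranks correspond one by one. Tuple and separating level stay arbitrary
  -- because the successor step passes to `a ∷ w` at a higher level.
  rk≥⇒ndrk≥ : ∀ α → Acc _<ₒ_ α → ∀ {n} (w : Vec Λ (suc (suc n))) → Unique w → ∀ {l} (sep : Separates w l) →
              Rk≥ model w α → Ndrk≥ (realise w l sep) α
  rk≥⇒ndrk≥ α _ w unique sep (at-zero α≈0 _) = at-zero α≈0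
  rk≥⇒ndrk≥ α (acc rs) w unique sep (at-limit lim rks) =
    at-limit lim λ β β<α → rk≥⇒ndrk≥ β (rs β<α) w unique sep (rks β β<α)
  rk≥⇒ndrk≥ α (acc rs) w unique {l} sep (at-suc β α≈@(_ , β<α) ext) = at-suc β α≈ λ ν ν∈ →
    extend ν (Realisation.locate w l sep ν ν∈)
    where
    extend : ∀ ν → (∃[ j ] ν ≡ pre l (η (lookup w j))) →
      ∃[ n ] (l < 𝐌.len n) × (realise w l sep ⊑ n) × Ndrk≥ n β ×
        AtLeast 2 (Subsetoid (setoid (Vec Bool (𝐌.len n)))
                             (λ τ → (τ ∈ᵤ 𝐌.u n) × (toList ν ◁ toList τ)))
    extend _ (j , refl) =
      -- The diagram is true of `w` itself; replacing the point that represents `ν` gives a new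
      -- point whose cut at `l` is again `ν`.
      let (a , a∉w , rk , sat) = ext (diagram w l) j (diagram-self w l)
          unique′ = ∉⇒All≢ w a∉w ∷ unique
          (l′ , l<l′ , sep′) = separates-beyond unique′ l
          agree = diagram-agree w (w [ j ]≔ a) l (Separates.0<l sep) sat
          module E = Extension sep l<l′ sep′ j agree
      in realise (a ∷ w) l′ sep′ , l<l′ , E.extends ,
         rk≥⇒ndrk≥ β (rs (β<α _)) (a ∷ w) unique′ sep′ rk , E.splits

  module _ {s : Ord} (ndrk≱s : (m : 𝐌 S ι) → ¬ Ndrk≥ m s) where

    -- Otherwise monotonicity would yield an element of 𝐌 of rank at least `s`.
    rk≥⇒< : ∀ {n} (w : Vec Λ (suc (suc n))) → Unique w → ∀ α → Rk≥ model w α → α <ₒ s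
    rk≥⇒< w unique α rk = ≰ₒ⇒>ₒ s α λ s≤α →
      let (l , _ , sep) = separates-beyond unique 0
      in ndrk≱s (realise w l sep)
           (ndrk≥-mono s (<ₒ-acc s) _ α s≤α (rk≥⇒ndrk≥ α (<ₒ-acc α) w unique sep rk))

    -- Singletons realise no element of 𝐌, so only a non-strict bound holds.
    rk≥⇒≤ : ∀ {n} (w : Vec Λ (suc n)) → Unique w → ∀ α → Rk≥ model w α → α ≤ₒ s
    rk≥⇒≤ w@(_ ∷ _ ∷ _) unique α rk = <ₒ⇒≤ₒ α s (rk≥⇒< w unique α rk)
    rk≥⇒≤ (x ∷ []) unique α (at-zero (α≤0 , _) _) = ≤ₒ-trans α zeroₒ s α≤0 λ ()
    -- A limit above `s` would have `sucₒ s` below it, and the bound at `sucₒ s` is absurd.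
    rk≥⇒≤ w@(x ∷ []) unique α (at-limit (_ , lim) rks) = ≮ₒ⇒≥ₒ s α λ s<α →
      <ₒ-irrefl s (rk≥⇒≤ w unique (sucₒ s) (rks (sucₒ s) (lim s s<α)) _)
    rk≥⇒≤ w@(x ∷ []) unique α (at-suc β (α≤ , _) ext) =
      -- Any true formula will do: only a second point is wanted, and the strict bound for two
      -- points then absorbs the extra step.
      let (a , a∉w , rk , _) = ext (equal (var zero) (var zero)) zero refl
          β<s = rk≥⇒< (a ∷ w) (∉⇒All≢ w a∉w ∷ unique) β rk
      in ≤ₒ-trans α (sucₒ β) s α≤ λ _ → β<s

    rank-≤ : ∀ {n} {w : Vec Λ (suc n)} → Unique w → ∀ {r} → HasRk model w r → r ≤ᵣ [ [ s ] ]₋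
    rank-≤ unique (minus-one _) = ⊥₋≤ _
    rank-≤ unique (ordinal {α} rk _) = [ [ rk≥⇒≤ _ unique α rk ]≤ ]≤₋
    rank-≤ unique (infinite rks) = contradiction (rk≥⇒≤ _ unique (sucₒ s) (rks (sucₒ s)) _) (<ₒ-irrefl s)

    -- The non-strict bound on singletons suffices: all ranks are at most `s`, hence so is their
    -- supremum, and `s` is strictly below `ε`.
    npr : ∀ {ε} → s <ₒ ε → NPr ε Λ
    npr {ε} s<ε =
      let (σ , isSup) = supᵣ (λ r → ∃[ n ] Σ (Vec Λ (suc n)) λ w → Unique w × HasRk model w r)
      in binary ι , model , σ , isSup , below (proj₂ isSup λ (_ , _ , unique , has) → rank-≤ unique has)
      where
      below : ∀ {σ} → σ ≤ᵣ [ [ s ] ]₋ → σ <ᵣ [ [ ε ] ]₋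
      below (⊥₋≤ _) = ⊥₋<[ _ ]
      below [ [_]≤ {α} α≤s ]≤₋ = [ [ ≤ₒ-<ₒ-trans α s ε α≤s s<ε ]< ]<₋

-- Choice of the common points and the lower bound for NDRK

corollary3p12 : ExcludedMiddle (lsuc 0ℓ) →
    (T : ℕ → Pred (List Bool) 0ℓ) →
    (∀ n → IsTree (T n)) →
    (∀ n → NoMaximalNodes (T n)) →
    (ι : ℕ) → 2 ≤ ι →
    (ω₁ : Ord) → IsFirstUncountable ω₁ →
    (ε : Ord) → ε ≤ₒ ω₁ →
    (Λ : Set) → Uncountable (setoid Λ) →
    Pr ε Λ →
    (A : Pred Cantor 0ℓ) → A Respects _≗_ →
    HasCardinality (Subsetoid Cantorₛ A) Λ →
    (∀ η ν → A η → A ν →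
    AtLeast (2 * ι) (Subsetoid Cantorₛ ((⋃lim T +ˢ η) ∩ (⋃lim T +ˢ ν)))) →
    ∃[ σ ] HasNDRK T ι σ × ([ ε ] ≤∞ σ)
corollary3p12 em T _ _ ι 2≤ι _ _ ε _ Λ _ pr A _ card many =
  let (σ , isNDRK) = sup∞ _ in σ , isNDRK , above σ isNDRK
  where
  open Classical em

  η : Λ → Cantor
  η a = proj₁ (Bijection.to card a)

  η-injective : ∀ {a b} → η a ≗ η b → a ≡ b
  η-injective = Bijection.injective card

  witness : ∀ a b → η a ≺ η b → OverlapWitness T ι (η a) (η b)
  witness a b (c , _ , ac , bc) = overlap-exists ι {c = c}
    (λ eq → contradiction (trans (sym ac) (trans eq bc)) λ ())
    (many (η a) (η b) (proj₂ (Bijection.to card a)) (proj₂ (Bijection.to card b)))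

  -- The choice has to be made once for {a , b}; ≺ orients the pair.  The last
  -- clause only concerns a = b, where the value is irrelevant.
  choice : Λ → Λ → (Fin ι → ℕ) × (Fin ι → Cantor)
  choice a b with em₀ {η a ≺ η b} | em₀ {η b ≺ η a}
  ... | yes a≺b | _       = let open OverlapWitness (witness a b a≺b) in h , g
  ... | no _    | yes b≺a = let open OverlapWitness (witness b a b≺a) in h′ , g′
  ... | no _    | no _    = (λ _ → 0) , λ _ _ → false

  overlaps : ∀ {a b} → a ≢ b → Overlap T (η a) (η b)
    (proj₁ (choice a b)) (proj₁ (choice b a)) (proj₂ (choice a b)) (proj₂ (choice b a))
  overlaps {a} {b} a≢b with em₀ {η a ≺ η b} | em₀ {η b ≺ η a}
  ... | yes a≺b | yes b≺a = contradiction b≺a (≺-asym a≺b)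
  ... | yes a≺b | no _    = OverlapWitness.overlaps (witness a b a≺b)
  ... | no _    | yes b≺a = overlap-flip (OverlapWitness.overlaps (witness b a b≺a))
  ... | no a⊀b  | no b⊀a  =
    -- Distinct points have sequences that differ at some digit and are therefore comparable, so the
    -- default value of `choice` never occurs here.
    let (n , ne) = ¬∀⇒∃¬ (a≢b ∘ η-injective) in
    contradiction (≺-total ne) Sum.[ a⊀b , b⊀a ]

  open Configurations em T (ℕ.<-trans (s≤s z≤n) 2≤ι) η η-injective
    (λ a b → proj₁ (choice a b)) (λ a b → proj₂ (choice a b)) overlaps using (npr)

  above : ∀ σ → HasNDRK T ι σ → [ ε ] ≤∞ σ
  above ⊤⁺    _      = [ ε ] ≤⊤⁺
  above [ s ] isNDRK = [ ≮ₒ⇒≥ₒ s ε (λ s<ε → pr (npr (NDRK-bound isNDRK) s<ε)) ]≤
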